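{- For every integer $n\ge 3$, the crown graph $K_{n,n}\setminus M$, where $M$ is a perfect matching, is a distance-transitive graph of diameter $3$ with intersection array $\{n-1,n-2,1;1,n-2,n-1\}$. Coloring each pair of distinct vertices by $b$, $a$, $c$ according as their distance is $1$, $2$, $3$ yields a representation of the relation algebra $26_{65}$ on $2n$ vertices, and this representation is algebraic.
   Context: A connected graph is distance-transitive if whenever $\operatorname{dist}(x,y)=\operatorname{dist}(u,v)$ some automorphism maps $x\mapsto u$, $y\mapsto v$. A distance-regular graph of diameter $3$ has intersection array $\{b_0,b_1,b_2;c_1,c_2,c_3\}$ where, for $\operatorname{dist}(x,y)=i$, $b_i$ (resp. $c_i$) is the number of neighbours of $y$ at distance $i+1$ (resp. $i-1$) from $x$. A cycle type is the multiset of colors of the sides of a triangle, e.g. $abb$ = one side $a$, two sides $b$. $26_{65}$ is the finite symmetric integral relation algebra with atoms $1',a,b,c$ whose mandatory diversity cycle types are exactly $aaa, abb, abc$ (all of $bbb,ccc,baa,acc,caa,bcc,cbb$ forbidden). A representation on a set $X$ is a coloring of all 2-element subsets of $X$ by $a,b,c$, each color used, such that: for every mandatory type $\{h,i,j\}$, every edge $\{x,y\}$ colored $h$ (for each choice of $h$ among the type's colors) and each ordering $(i,j)$ of the remaining two colors, some $z$ has $\{x,z\}$ colored $i$, $\{z,y\}$ colored $j$; and no triangle of a forbidden type occurs. A representation on a finite set is algebraic if each color class (viewed as a set of ordered pairs, together with the diagonal as the identity class) is a single orbit on ordered pairs of the group of color-preserving permutations of $X$. -}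

module Defs where

open import Data.Fin using (Fin; toℕ)
open import Data.List using (List; []; _∷_; length)
open import Data.List.Membership.Propositional using (_∈_)
open import Data.List.Relation.Binary.Permutation.Propositional using (_↭_)
open import Data.List.Relation.Unary.Any using (Any)
open import Data.List.Relation.Unary.Unique.Propositional using (Unique)
open import Data.Nat using (ℕ; zero; suc; _≤_)
open import Data.Product using (Σ; ∃; ∃!; ∃-syntax; Σ-syntax; _×_; _,_)
open import Data.Sum using (_⊎_; inj₁; inj₂)
open import Data.Unit using (⊤; tt)
open import Data.Empty using (⊥)
open import Data.Vec using (Vec; lookup)
open import Function.Bundles using (_↔_; _⇔_; Inverse)
open import Level using (0ℓ)
open import Relation.Binary.Core using (Rel)
open import Relation.Binary.PropositionalEquality using (_≡_; _≢_)
open import Relation.Nullary using (¬_)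
open import Relation.Unary using (Pred)

open Inverse using (to)

-- The list formulation, unlike Fin k ↔ Σ X P, does not count distinct
-- proofs of P x separately.
HasCardinality : {X : Set} → Pred X 0ℓ → ℕ → Set
HasCardinality {X} P k =
  Σ[ xs ∈ List X ] Unique xs × (∀ x → x ∈ xs ⇔ P x) × length xs ≡ k

record Graph (V : Set) : Set₁ where
  field
    Adj    : Rel V 0ℓ
    sym    : ∀ {x y} → Adj x y → Adj y x
    irrefl : ∀ {x} → ¬ Adj x x

open Graph public using (Adj)

module _ {V : Set} where

  data Walk (G : Graph V) : ℕ → V → V → Set where
    []  : ∀ {x} → Walk G zero x x
    _∷_ : ∀ {k x y z} → Adj G x y → Walk G k y z → Walk G (suc k) x z

  -- dist(x,y) = k
  Dist : Graph V → ℕ → V → V → Set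
  Dist G k x y = Walk G k x y × (∀ m → Walk G m x y → k ≤ m)

  Connected : Graph V → Set
  Connected G = ∀ x y → ∃[ k ] Walk G k x y

  HasDiameter : Graph V → ℕ → Set
  HasDiameter G d =
    (∀ x y → ∃[ k ] k ≤ d × Dist G k x y) ×
    (∃[ x ] ∃[ y ] Dist G d x y)

  IsAutomorphism : Graph V → V ↔ V → Set
  IsAutomorphism G φ = ∀ x y → Adj G x y ⇔ Adj G (to φ x) (to φ y)

  IsDistanceTransitive : Graph V → Set
  IsDistanceTransitive G =
    Connected G ×
    (∀ k x y u v → Dist G k x y → Dist G k u v →
      Σ[ φ ∈ V ↔ V ] IsAutomorphism G φ × to φ x ≡ u × to φ y ≡ v)

  -- G is distance-regular of diameter d with array
  -- {b₀,…,b_{d-1}; c₁,…,c_d}; note that lookup c i is c_{i+1}.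
  HasIntersectionArray : {d : ℕ} → Graph V → Vec ℕ d → Vec ℕ d → Set
  HasIntersectionArray {d} G b c =
    Connected G ×
    HasDiameter G d ×
    (∀ (i : Fin d) x y → Dist G (toℕ i) x y →
      HasCardinality (λ z → Adj G y z × Dist G (suc (toℕ i)) x z) (lookup b i)) ×
    (∀ (i : Fin d) x y → Dist G (suc (toℕ i)) x y →
      HasCardinality (λ z → Adj G y z × Dist G (toℕ i) x z) (lookup c i))

  -- M is given as the spanning subgraph whose edges are the matching edges.
  IsPerfectMatching : Graph V → Graph V → Set
  IsPerfectMatching G M =
    (∀ x y → Adj M x y → Adj G x y) × (∀ x → ∃! _≡_ (Adj M x))

  infixl 6 _∖_
  _∖_ : Graph V → Graph V → Graph V
  G ∖ M = record
    { Adj    = λ x y → Adj G x y × ¬ Adj M x y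
    ; sym    = λ (g , ¬m) → Graph.sym G g , λ m → ¬m (Graph.sym M m)
    ; irrefl = λ (g , _) → Graph.irrefl G g
    }

completeBipartite : (m n : ℕ) → Graph (Fin m ⊎ Fin n)
completeBipartite m n = record
  { Adj = adj ; sym = λ {x} {y} → adj-sym x y ; irrefl = λ {x} → adj-irrefl x }
  where
  adj : Rel (Fin m ⊎ Fin n) 0ℓ
  adj (inj₁ _) (inj₁ _) = ⊥
  adj (inj₁ _) (inj₂ _) = ⊤
  adj (inj₂ _) (inj₁ _) = ⊤
  adj (inj₂ _) (inj₂ _) = ⊥

  adj-sym : ∀ x y → adj x y → adj y x
  adj-sym (inj₁ _) (inj₂ _) _ = tt
  adj-sym (inj₂ _) (inj₁ _) _ = tt

  adj-irrefl : ∀ x → ¬ adj x x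
  adj-irrefl (inj₁ _) ()
  adj-irrefl (inj₂ _) ()

-- The data determining a finite symmetric integral relation algebra: its
-- diversity atoms and its mandatory diversity cycle types (multisets of three
-- diversity atoms).  Every cycle type not listed is forbidden.
record SymmetricAtomStructure : Set₁ where
  field
    DiversityAtom  : Set
    mandatoryTypes : List (DiversityAtom × DiversityAtom × DiversityAtom)

  Mandatory : (h i j : DiversityAtom) → Set
  Mandatory h i j =
    Any (λ (p , q , r) → (h ∷ i ∷ j ∷ []) ↭ (p ∷ q ∷ r ∷ [])) mandatoryTypes

  Forbidden : (h i j : DiversityAtom) → Set
  Forbidden h i j = ¬ Mandatory h i j

open SymmetricAtomStructure public using (DiversityAtom; Mandatory; Forbidden)

data Colour : Set where
  a b c : Colour

atoms26₆₅ : SymmetricAtomStructure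
atoms26₆₅ = record
  { DiversityAtom  = Colour
  ; mandatoryTypes = (a , a , a) ∷ (a , b , b) ∷ (a , b , c) ∷ []
  }

-- A colouring of the 2-element subsets of X: irrelevance and symmetry make
-- the colour depend on the unordered pair {x , y} only.
record Colouring (X C : Set) : Set where
  field
    colour     : (x y : X) → .(x ≢ y) → C
    colour-sym : ∀ x y (x≢y : x ≢ y) (y≢x : y ≢ x) →
                 colour x y x≢y ≡ colour y x y≢x

open Colouring public using (colour)

module _ {X C : Set} where

  -- The colour class of h, as a set of ordered pairs.
  Coloured : Colouring X C → C → Rel X 0ℓ
  Coloured κ h x y = Σ[ x≢y ∈ x ≢ y ] colour κ x y x≢y ≡ h

  IsColourPreserving : Colouring X C → X ↔ X → Set
  IsColourPreserving κ φ =
    ∀ h x y → Coloured κ h x y → Coloured κ h (to φ x) (to φ y)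

  -- R is a single orbit, on ordered pairs, of the group of colour-preserving
  -- permutations.
  IsOrbit : Colouring X C → Rel X 0ℓ → Set
  IsOrbit κ R =
    ∃[ x ] ∃[ y ] R x y ×
      (∀ u v → R u v ⇔
        (Σ[ φ ∈ X ↔ X ] IsColourPreserving κ φ × to φ x ≡ u × to φ y ≡ v))

  -- The first component says that the identity class is an orbit.
  IsAlgebraic : Colouring X C → Set
  IsAlgebraic κ = IsOrbit κ _≡_ × (∀ h → IsOrbit κ (Coloured κ h))

-- Mandatory is invariant under permuting its arguments, so quantifying over
-- all h i j covers every choice of h and both orderings of the other two.
record IsRepresentation {X : Set} (A : SymmetricAtomStructure)
                        (κ : Colouring X (DiversityAtom A)) : Set where
  field
    used      : ∀ h → ∃[ x ] ∃[ y ] Coloured κ h x y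
    mandatory : ∀ h i j → Mandatory A h i j → ∀ x y → Coloured κ h x y →
                ∃[ z ] Coloured κ i x z × Coloured κ j z y
    forbidden : ∀ h i j → Forbidden A h i j → ∀ x y z →
                ¬ (Coloured κ h x y × Coloured κ i y z × Coloured κ j x z)

IsDistanceColouring : {V : Set} → Graph V → Colouring V Colour → Set
IsDistanceColouring G κ =
  ∀ x y → (Coloured κ b x y ⇔ Dist G 1 x y) ×
          (Coloured κ a x y ⇔ Dist G 2 x y) ×
          (Coloured κ c x y ⇔ Dist G 3 x y)

{-# OPTIONS --safe #-}
-- The matching puts the vertices in bijection with {0,1} × {1,…,n}: the first
-- coordinate is the side, and two vertices have the same second coordinate iff
-- they are equal or matched.  Adjacency in the crown graph means differing in
-- both coordinates, so the distance of two vertices depends only on which of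
-- their coordinates agree: 0 both, 1 neither, 2 the side only, 3 the second
-- coordinate only.  Since Sym(2) × Sym(n) acts on the vertices and Sym(m) is
-- transitive on pairs of distinct points for every m, every distance class is
-- one orbit.
module Submission where

open import Defs
open import Data.Bool using (Bool; true; false; _xor_)
open import Data.Empty using (⊥-elim)
open import Data.Fin using (Fin; zero; suc; toℕ; opposite; _≟_)
open import Data.Fin.Patterns using (0F; 1F; 2F)
open import Data.Fin.Permutation using (Permutation′; _⟨$⟩ʳ_; transpose; _∘ₚ_)
open import Data.Fin.Properties using (*↔×)
open import Data.List using (_∷_; []; _++_; map; length; allFin)
open import Data.List.Properties using (length-map; length-tabulate)
open import Data.List.Membership.Propositional using (_∈_)
open import Data.List.Membership.Propositional.Properties
  using (∈-map⁺; ∈-map⁻; ∈-allFin; ∈-∃++)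
open import Data.List.Relation.Binary.Permutation.Propositional
  using (_↭_; ↭-refl; ↭-sym; ↭-trans; ↭-prep; ↭-swap; ↭⇒↭ₛ)
open import Data.List.Relation.Binary.Permutation.Propositional.Properties
  using (∈-resp-↭; ↭-length; map⁺; shift)
import Data.List.Relation.Binary.Permutation.Setoid.Properties as Setoid↭
import Data.List.Relation.Unary.All as All
open import Data.List.Relation.Unary.AllPairs as AllPairs using (_∷_)
open import Data.List.Relation.Unary.Any using (here; there)
import Data.List.Relation.Unary.Unique.Propositional.Properties as Unique
open import Data.Nat using (ℕ; suc; _≤_; _∸_; _*_; _+_; z≤n; s≤s)
open import Data.Nat.ListAction using (sum)
open import Data.Nat.ListAction.Properties using (sum-↭)
open import Data.Nat.Properties using (≤-antisym; ≤-trans; ∸-+-assoc)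
open import Data.Product using (Σ-syntax; ∃-syntax; _×_; _,_; proj₁; proj₂)
open import Data.Product.Function.NonDependent.Propositional using (_×-↔_; _×-⇔_)
open import Data.Sum using (_⊎_; inj₁; inj₂)
open import Data.Sum.Properties using (inj₁-injective; inj₂-injective)
open import Data.Unit using (tt)
open import Data.Vec using (Vec; _∷_; []; lookup)
open import Function.Base using (_∘_; id)
open import Function.Bundles using (_↔_; _⇔_; mk⇔; mk↔ₛ′; Equivalence; Injection; Inverse)
open import Function.Construct.Composition using (_⇔-∘_; _↔-∘_)
open import Function.Construct.Symmetry using (⇔-sym)
open import Function.Properties.Inverse using (↔-sym; ↔⇒↣)
open import Level using (0ℓ)
open import Relation.Binary.PropositionalEquality
  using (_≡_; _≢_; refl; sym; trans; cong; cong₂; subst; subst₂; setoid; ≢-sym)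
open import Relation.Nullary using (¬_; yes; no; contradiction)
open import Relation.Nullary.Decidable using (dec-true; dec-false)
open import Relation.Unary using (Pred; U)

open Inverse using (to; from; strictlyInverseˡ; strictlyInverseʳ)

to-injective : {A B : Set} (f : A ↔ B) {x y : A} → to f x ≡ to f y → x ≡ y
to-injective f = Injection.injective (↔⇒↣ f)

-- Cardinalities

module _ {A : Set} where

  cardinality-cong : {P Q : Pred A 0ℓ} {k : ℕ} →
    (∀ x → P x ⇔ Q x) → HasCardinality P k → HasCardinality Q k
  cardinality-cong P⇔Q (xs , xs! , ∈⇔P , len) =
    xs , xs! , (λ x → P⇔Q x ⇔-∘ ∈⇔P x) , len

  cardinality-map : {B : Set} {P : Pred A 0ℓ} {k : ℕ} (f : A → B) →
    (∀ {x y} → f x ≡ f y → x ≡ y) → HasCardinality P k →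
    HasCardinality (λ y → ∃[ x ] P x × y ≡ f x) k
  cardinality-map f f-inj (xs , xs! , ∈⇔P , len) =
    map f xs , Unique.map⁺ f-inj xs! ,
    (λ y → mk⇔
      (λ y∈ → let x , x∈ , y≡ = ∈-map⁻ f y∈ in x , Equivalence.to (∈⇔P x) x∈ , y≡)
      (λ { (x , px , refl) → ∈-map⁺ f (Equivalence.from (∈⇔P x) px) })) ,
    trans (length-map f xs) len

  cardinality-remove : {P : Pred A 0ℓ} {k : ℕ} {x : A} → P x →
    HasCardinality P k → HasCardinality (λ y → P y × y ≢ x) (k ∸ 1)
  cardinality-remove {P} {k} {x} px (xs , xs! , ∈⇔P , refl)
    with ys , zs , refl ← ∈-∃++ (Equivalence.from (∈⇔P x) px)
    -- Moving `x` to the front is a permutation, so the list stays duplicate-free. This yields at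
    -- once that `x` is absent from the remainder and that the remainder is duplicate-free.
    with x∉ ∷ rest! ← Setoid↭.Unique-resp-↭ (setoid A) (↭⇒↭ₛ (shift x ys zs)) xs! =
    ys ++ zs , rest! , (λ y → mk⇔
      (λ y∈ → Equivalence.to (∈⇔P y) (∈-resp-↭ (↭-sym (shift x ys zs)) (there y∈)) ,
              (λ y≡x → All.lookup x∉ y∈ (sym y≡x)))
      (λ (py , y≢x) → drop-head y≢x
        (∈-resp-↭ (shift x ys zs) (Equivalence.from (∈⇔P y) py)))) ,
    cong (_∸ 1) (sym (↭-length (shift x ys zs)))
    where
    drop-head : ∀ {y ws} → y ≢ x → y ∈ x ∷ ws → y ∈ ws
    drop-head y≢x (here y≡x) = contradiction y≡x y≢x
    drop-head y≢x (there y∈) = y∈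

  cardinality-singleton : (x : A) → HasCardinality (_≡ x) 1
  cardinality-singleton x =
    x ∷ [] , All.[] ∷ AllPairs.[] ,
    (λ y → mk⇔ (λ { (here y≡x) → y≡x ; (there ()) }) here) , refl

cardinality-↔ : {A B : Set} {P : Pred B 0ℓ} {k : ℕ} (f : A ↔ B) →
  HasCardinality P k → HasCardinality (P ∘ to f) k
cardinality-↔ {P = P} f = cardinality-cong
  (λ x → mk⇔ (λ { (y , py , refl) → subst P (sym (strictlyInverseˡ f y)) py })
             (λ p → to f x , p , sym (strictlyInverseʳ f x)))
  ∘ cardinality-map (from f) (to-injective (↔-sym f))

cardinality-Fin : ∀ n → HasCardinality {Fin n} U n
cardinality-Fin n =
  allFin n , Unique.allFin⁺ n , (λ i → mk⇔ _ (λ _ → ∈-allFin i)) , length-tabulate id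

-- Finite sets

module _ {n : ℕ} where

  cardinality-≢ : (i : Fin n) → HasCardinality (_≢ i) (n ∸ 1)
  cardinality-≢ i = cardinality-cong (λ _ → mk⇔ proj₂ (tt ,_))
    (cardinality-remove tt (cardinality-Fin n))

  cardinality-≢-≢ : {i j : Fin n} → i ≢ j →
    HasCardinality (λ k → k ≢ i × k ≢ j) (n ∸ 2)
  cardinality-≢-≢ {i} {j} i≢j =
    subst (HasCardinality _) (∸-+-assoc n 1 1)
      (cardinality-remove (≢-sym i≢j) (cardinality-≢ i))

  transpose-left : (i j : Fin n) → transpose i j ⟨$⟩ʳ i ≡ j
  transpose-left i j rewrite dec-true (i ≟ i) refl = refl

  transpose-fixes : {i j k : Fin n} → k ≢ i → k ≢ j → transpose i j ⟨$⟩ʳ k ≡ k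
  transpose-fixes {i} {j} {k} k≢i k≢j
    rewrite dec-false (k ≟ i) k≢i | dec-false (k ≟ j) k≢j = refl

  -- Transitivity on points and on pairs of distinct points in one statement, the equivalence
  -- telling the two cases apart.
  permutation-on-pairs : (i j k l : Fin n) → (i ≡ j ⇔ k ≡ l) →
    Σ[ π ∈ Permutation′ n ] π ⟨$⟩ʳ i ≡ k × π ⟨$⟩ʳ j ≡ l
  permutation-on-pairs i j k l eq with i ≟ j
  ... | yes refl = transpose i k , transpose-left i k ,
                   trans (transpose-left i k) (Equivalence.to eq refl)
  -- First `π` takes `i` to `k`; then the image of `j` is exchanged with `l`. The second
  -- transposition leaves `k` in place because `k` is neither of the exchanged points.
  ... | no i≢j = π ∘ₚ transpose (π ⟨$⟩ʳ j) l ,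
                 trans (cong (transpose (π ⟨$⟩ʳ j) l ⟨$⟩ʳ_) πi≡k)
                       (transpose-fixes k≢πj (i≢j ∘ Equivalence.from eq)) ,
                 transpose-left (π ⟨$⟩ʳ j) l
    where
    π = transpose i k
    πi≡k = transpose-left i k
    k≢πj : k ≢ π ⟨$⟩ʳ j
    k≢πj k≡πj = i≢j (to-injective π (trans πi≡k k≡πj))

≢-opposite : (s : Fin 2) → s ≢ opposite s
≢-opposite 0F ()
≢-opposite 1F ()

≢⇒≡opposite : {s t : Fin 2} → s ≢ t → t ≡ opposite s
≢⇒≡opposite {0F} {0F} s≢t = contradiction refl s≢t
≢⇒≡opposite {0F} {1F} s≢t = refl
≢⇒≡opposite {1F} {0F} s≢t = refl
≢⇒≡opposite {1F} {1F} s≢t = contradiction refl s≢t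

-- Pigeonhole on the two sides; this prevents two edges from joining matched vertices.
≢-≢⇒≡ : {s t u : Fin 2} → s ≢ t → t ≢ u → s ≡ u
≢-≢⇒≡ s≢t t≢u = trans (≢⇒≡opposite (≢-sym s≢t)) (sym (≢⇒≡opposite t≢u))

-- A third index outside `i` and `j` is among the first three. The bound 3 ≤ n enters here,
-- supplying the fresh coordinate that completes triangles.
avoid-two : ∀ {m} (i j : Fin (3 + m)) → ∃[ k ] i ≢ k × k ≢ j
avoid-two (suc _) (suc _)       = 0F , (λ ()) , λ ()
avoid-two zero    zero          = 1F , (λ ()) , λ ()
avoid-two zero    1F            = 2F , (λ ()) , λ ()
avoid-two zero    (suc (suc _)) = 1F , (λ ()) , λ ()
avoid-two 1F            zero    = 2F , (λ ()) , λ ()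
avoid-two (suc (suc _)) zero    = 1F , (λ ()) , λ ()

-- The intersection numbers: entry `i` of `outward n` belongs to distance i, entry `i` of `inward n`
-- to distance i + 1.
outward inward : ℕ → Vec ℕ 3
outward n = (n ∸ 1) ∷ (n ∸ 2) ∷ 1 ∷ []
inward n  = 1 ∷ (n ∸ 2) ∷ (n ∸ 1) ∷ []

-- Relative position of two vertices in coordinates

data At {n : ℕ} : ℕ → (p q : Fin 2 × Fin n) → Set where
  equal    : ∀ {s i} → At 0 (s , i) (s , i)
  adjacent : ∀ {s t i j} → s ≢ t → i ≢ j → At 1 (s , i) (t , j)
  aside    : ∀ {s i j} → i ≢ j → At 2 (s , i) (s , j)
  matched  : ∀ {s t i} → s ≢ t → At 3 (s , i) (t , i)

module _ {n : ℕ} where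

  position : (p q : Fin 2 × Fin n) → ∃[ k ] k ≤ 3 × At k p q
  position (s , i) (t , j) with s ≟ t | i ≟ j
  ... | yes refl | yes refl = 0 , z≤n , equal
  ... | no s≢t   | no i≢j   = 1 , s≤s z≤n , adjacent s≢t i≢j
  ... | yes refl | no i≢j   = 2 , s≤s (s≤s z≤n) , aside i≢j
  ... | no s≢t   | yes refl = 3 , s≤s (s≤s (s≤s z≤n)) , matched s≢t

  At-unique : ∀ {k l} {p q : Fin 2 × Fin n} → At k p q → At l p q → k ≡ l
  At-unique equal            equal            = refl
  At-unique equal            (adjacent s≢s _) = contradiction refl s≢s
  At-unique equal            (aside i≢i)      = contradiction refl i≢i
  At-unique equal            (matched s≢s)    = contradiction refl s≢s
  At-unique (adjacent s≢s _) equal            = contradiction refl s≢s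
  At-unique (adjacent _ _)   (adjacent _ _)   = refl
  At-unique (adjacent s≢s _) (aside _)        = contradiction refl s≢s
  At-unique (adjacent _ i≢i) (matched _)      = contradiction refl i≢i
  At-unique (aside i≢i)      equal            = contradiction refl i≢i
  At-unique (aside _)        (adjacent s≢s _) = contradiction refl s≢s
  At-unique (aside _)        (aside _)        = refl
  At-unique (aside _)        (matched s≢s)    = contradiction refl s≢s
  At-unique (matched s≢s)    equal            = contradiction refl s≢s
  At-unique (matched _)      (adjacent _ i≢i) = contradiction refl i≢i
  At-unique (matched s≢s)    (aside _)        = contradiction refl s≢s
  At-unique (matched _)      (matched _)      = refl

  At-0⇒≡ : {p q : Fin 2 × Fin n} → At 0 p q → p ≡ q
  At-0⇒≡ equal = refl

  At-sym : ∀ {k} {p q : Fin 2 × Fin n} → At k p q → At k q p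
  At-sym equal              = equal
  At-sym (adjacent s≢t i≢j) = adjacent (≢-sym s≢t) (≢-sym i≢j)
  At-sym (aside i≢j)        = aside (≢-sym i≢j)
  At-sym (matched s≢t)      = matched (≢-sym s≢t)

  -- The bound is at risk only for `k` equal to 2 or 3 with `l = 0`, and for `k = 3` with `l = 1`.
  -- If `l = 0`, then `r` is `q`, which is adjacent to `p`. If `l = 1`, two changes of side lead
  -- back to the side of `p`, while a matched vertex lies opposite.
  At-step : ∀ {k l} {p q r : Fin 2 × Fin n} →
    At 1 p q → At l q r → At k p r → k ≤ suc l
  At-step _                _                equal          = z≤n
  At-step _                _                (adjacent _ _) = s≤s z≤n
  At-step (adjacent s≢s _) equal            (aside _)      = contradiction refl s≢s
  At-step _                (adjacent _ _)   (aside _)      = s≤s (s≤s z≤n)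
  At-step _                (aside _)        (aside _)      = s≤s (s≤s z≤n)
  At-step _                (matched _)      (aside _)      = s≤s (s≤s z≤n)
  At-step (adjacent _ i≢i) equal            (matched _)    = contradiction refl i≢i
  At-step (adjacent s≢t _) (adjacent t≢u _) (matched s≢u) =
    contradiction (≢-≢⇒≡ s≢t t≢u) s≢u
  At-step _                (aside _)        (matched _) = s≤s (s≤s (s≤s z≤n))
  At-step (adjacent _ i≢i) (matched _)      (matched _) = contradiction refl i≢i

  -- The action of Sym(2) × Sym(n) on coordinates

  Permutation² : Set
  Permutation² = Permutation′ 2 × Permutation′ n

  act : Permutation² → (Fin 2 × Fin n) ↔ (Fin 2 × Fin n)
  act (ρ , π) = ρ ×-↔ π

  act-At : ∀ {k p q} (g : Permutation²) → At k p q → At k (to (act g) p) (to (act g) q)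
  act-At _       equal              = equal
  act-At (ρ , π) (adjacent s≢t i≢j) = adjacent (s≢t ∘ to-injective ρ) (i≢j ∘ to-injective π)
  act-At (ρ , π) (aside i≢j)        = aside (i≢j ∘ to-injective π)
  act-At (ρ , π) (matched s≢t)      = matched (s≢t ∘ to-injective ρ)

  -- Equal positions mean the same pattern of agreement in each coordinate separately. That pattern
  -- is the hypothesis of `permutation-on-pairs`, and the two permutations can be chosen
  -- independently.
  act-transitive : ∀ {k p q u v} → At k p q → At k u v →
    Σ[ g ∈ Permutation² ] to (act g) p ≡ u × to (act g) q ≡ v
  act-transitive {p = s , i} {t , j} {s′ , i′} {t′ , j′} pq uv =
    let ρ , ρs , ρt = permutation-on-pairs s t s′ t′ (proj₁ (agree pq uv))
        π , πi , πj = permutation-on-pairs i j i′ j′ (proj₂ (agree pq uv))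
    in (ρ , π) , cong₂ _,_ ρs πi , cong₂ _,_ ρt πj
    where
    both : {A B : Set} → A → B → A ⇔ B
    both x y = mk⇔ (λ _ → y) (λ _ → x)

    neither : {A B : Set} → ¬ A → ¬ B → A ⇔ B
    neither ¬x ¬y = mk⇔ (⊥-elim ∘ ¬x) (⊥-elim ∘ ¬y)

    agree : ∀ {k s t s′ t′} {i j i′ j′ : Fin n} →
      At k (s , i) (t , j) → At k (s′ , i′) (t′ , j′) →
      (s ≡ t ⇔ s′ ≡ t′) × (i ≡ j ⇔ i′ ≡ j′)
    agree equal          equal          = both refl refl , both refl refl
    agree (adjacent x y) (adjacent z w) = neither x z , neither y w
    agree (aside x)      (aside y)      = both refl refl , neither x y
    agree (matched x)    (matched y)    = neither x y , both refl refl

  -- Intersection numbers in coordinates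

  cardinality-on-side : {P : Pred (Fin n) 0ℓ} {k : ℕ} (s : Fin 2) →
    HasCardinality P k → HasCardinality (λ (t , i) → t ≡ s × P i) k
  cardinality-on-side s = cardinality-cong
    (λ _ → mk⇔ (λ { (_ , pi , refl) → refl , pi }) (λ { (refl , pi) → _ , pi , refl }))
    ∘ cardinality-map (s ,_) (λ { refl → refl })

  -- The vertices counted share one side, so only second coordinates are counted. From distance 0
  -- they avoid one index, from distance 1 they lie on the side of `p` and avoid two, and from
  -- distance 2 only the partner of `p` remains.
  cardinality-outward : ∀ i {p q : Fin 2 × Fin n} → At (toℕ i) p q →
    HasCardinality (λ r → At 1 q r × At (suc (toℕ i)) p r) (lookup (outward n) i)
  cardinality-outward 0F (equal {s} {i}) = cardinality-cong
    (λ _ → mk⇔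
      (λ { (refl , k≢i) → adjacent (≢-opposite s) (≢-sym k≢i) , adjacent (≢-opposite s) (≢-sym k≢i) })
      (λ { (adjacent s≢t i≢k , _) → ≢⇒≡opposite s≢t , ≢-sym i≢k }))
    (cardinality-on-side (opposite s) (cardinality-≢ i))
  cardinality-outward 1F (adjacent {s} s≢t i≢j) = cardinality-cong
    (λ _ → mk⇔
      (λ { (refl , k≢i , k≢j) → adjacent (≢-sym s≢t) (≢-sym k≢j) , aside (≢-sym k≢i) })
      (λ { (adjacent _ j≢k , aside i≢k) → refl , ≢-sym i≢k , ≢-sym j≢k }))
    (cardinality-on-side s (cardinality-≢-≢ i≢j))
  cardinality-outward 2F (aside {s} {i} i≢j) = cardinality-cong
    (λ _ → mk⇔
      (λ { (refl , refl) → adjacent (≢-opposite s) (≢-sym i≢j) , matched (≢-opposite s) })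
      (λ { (_ , matched s≢t) → ≢⇒≡opposite s≢t , refl }))
    (cardinality-on-side (opposite s) (cardinality-singleton i))

  -- At distance 1 only `p` itself counts. At distance 2 the common neighbours lie opposite and
  -- avoid both indices; at distance 3 they lie on the side of `p` and avoid the shared index.
  cardinality-inward : ∀ i {p q : Fin 2 × Fin n} → At (suc (toℕ i)) p q →
    HasCardinality (λ r → At 1 q r × At (toℕ i) p r) (lookup (inward n) i)
  cardinality-inward 0F {p} pq = cardinality-cong
    (λ _ → mk⇔ (λ { refl → At-sym pq , equal }) (λ { (_ , equal) → refl }))
    (cardinality-singleton p)
  cardinality-inward 1F (aside {s} i≢j) = cardinality-cong
    (λ _ → mk⇔
      (λ { (refl , k≢i , k≢j) → adjacent (≢-opposite s) (≢-sym k≢j) ,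
                                adjacent (≢-opposite s) (≢-sym k≢i) })
      (λ { (adjacent s≢t j≢k , adjacent _ i≢k) → ≢⇒≡opposite s≢t , ≢-sym i≢k , ≢-sym j≢k }))
    (cardinality-on-side (opposite s) (cardinality-≢-≢ i≢j))
  cardinality-inward 2F (matched {s} {i = i} s≢t) = cardinality-cong
    (λ _ → mk⇔
      (λ { (refl , k≢i) → adjacent (≢-sym s≢t) (≢-sym k≢i) , aside (≢-sym k≢i) })
      (λ { (_ , aside i≢k) → refl , ≢-sym i≢k }))
    (cardinality-on-side s (cardinality-≢ i))

-- Cycle types of 26₆₅

-- The 1 + 3 + 6 orderings of the three mandatory types, listed so that triangles can be treated by
-- pattern matching instead of through list permutations.
data Cycle : (h i j : Colour) → Set where
  aaa : Cycle a a a
  abb : Cycle a b b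
  bab : Cycle b a b
  bba : Cycle b b a
  abc : Cycle a b c
  acb : Cycle a c b
  bac : Cycle b a c
  bca : Cycle b c a
  cab : Cycle c a b
  cba : Cycle c b a

mandatory⇒cycle : ∀ h i j → Mandatory atoms26₆₅ h i j → Cycle h i j
mandatory⇒cycle h i j = λ where
    (here hij↭)                 → sum-0 h i j (weigh hij↭)
    (there (here hij↭))         → sum-2 h i j (weigh hij↭)
    (there (there (here hij↭))) → sum-5 h i j (weigh hij↭)
  where
  -- In base 4 these weights make the sum determine a multiset of size 3.
  weight : Colour → ℕ
  weight a = 0
  weight b = 1
  weight c = 4

  weigh : ∀ {xs ys} → xs ↭ ys → sum (map weight xs) ≡ sum (map weight ys)
  weigh = sum-↭ ∘ map⁺ weight

  sum-0 : ∀ h i j → sum (map weight (h ∷ i ∷ j ∷ [])) ≡ 0 → Cycle h i j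
  sum-0 a a a refl = aaa

  sum-2 : ∀ h i j → sum (map weight (h ∷ i ∷ j ∷ [])) ≡ 2 → Cycle h i j
  sum-2 a a a ()
  sum-2 a b b refl = abb
  sum-2 b a b refl = bab
  sum-2 b b a refl = bba

  sum-5 : ∀ h i j → sum (map weight (h ∷ i ∷ j ∷ [])) ≡ 5 → Cycle h i j
  sum-5 a a a ()
  sum-5 a b c refl = abc
  sum-5 a c b refl = acb
  sum-5 b b a ()
  sum-5 b a c refl = bac
  sum-5 b c a refl = bca
  sum-5 c a b refl = cab
  sum-5 c b a refl = cba

cycle⇒mandatory : ∀ {h i j} → Cycle h i j → Mandatory atoms26₆₅ h i j
cycle⇒mandatory = λ where
    aaa → here ↭-refl
    abb → there (here ↭-refl)
    bab → there (here (↭-swap b a ↭-refl))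
    bba → there (here (↭-trans (↭-prep b (↭-swap b a ↭-refl)) (↭-swap b a ↭-refl)))
    abc → there (there (here ↭-refl))
    acb → there (there (here (↭-prep a (↭-swap c b ↭-refl))))
    bac → there (there (here (↭-swap b a ↭-refl)))
    bca → there (there (here (↭-trans (↭-prep b (↭-swap c a ↭-refl)) (↭-swap b a ↭-refl))))
    cab → there (there (here (↭-trans (↭-swap c a ↭-refl) (↭-prep a (↭-swap c b ↭-refl)))))
    cba → there (there (here (↭-trans (↭-swap c b ↭-refl)
            (↭-trans (↭-prep b (↭-swap c a ↭-refl)) (↭-swap b a ↭-refl)))))

-- Colours as distances, and completion of mandatory triangles

distanceOf : Colour → ℕ
distanceOf b = 1
distanceOf a = 2
distanceOf c = 3

-- Junk value c at 0, which is never the distance of distinct vertices.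
colourAt : ℕ → Colour
colourAt 1 = b
colourAt 2 = a
colourAt _ = c

colourAt-distanceOf : ∀ h → colourAt (distanceOf h) ≡ h
colourAt-distanceOf a = refl
colourAt-distanceOf b = refl
colourAt-distanceOf c = refl

module _ {m : ℕ} where

  complete-triangle : ∀ {h i j} {p q : Fin 2 × Fin (3 + m)} → Cycle h i j →
    At (distanceOf h) p q →
    ∃[ r ] At (distanceOf i) p r × At (distanceOf j) r q
  -- The side of `r` follows from which edges change sides. Its second coordinate is copied from an
  -- endpoint joined to it by `c`, and is otherwise the fresh `k`.
  complete-triangle {p = s , i} {t , j} cyc pq with k , i≢k , k≢j ← avoid-two i j | cyc | pq
  ... | aaa | aside i≢j        = (s , k) , aside i≢k , aside k≢j
  ... | abb | aside i≢j        = (opposite s , k) ,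
    adjacent (≢-opposite s) i≢k , adjacent (≢-sym (≢-opposite s)) k≢j
  ... | bab | adjacent s≢t i≢j = (s , k) , aside i≢k , adjacent s≢t k≢j
  ... | bba | adjacent s≢t i≢j = (t , k) , adjacent s≢t i≢k , aside k≢j
  ... | abc | aside i≢j        = (opposite s , j) ,
    adjacent (≢-opposite s) i≢j , matched (≢-sym (≢-opposite s))
  ... | acb | aside i≢j        = (opposite s , i) ,
    matched (≢-opposite s) , adjacent (≢-sym (≢-opposite s)) i≢j
  ... | bac | adjacent s≢t i≢j = (s , j) , aside i≢j , matched s≢t
  ... | bca | adjacent s≢t i≢j = (t , i) , matched s≢t , aside i≢j
  ... | cab | matched s≢t      = (s , k) , aside i≢k , adjacent s≢t k≢j
  ... | cba | matched s≢t      = (t , k) , adjacent s≢t i≢k , aside k≢j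

-- Parity of side changes around a triangle

crosses : Colour → Bool
crosses a = false
crosses b = true
crosses c = true

differ : Fin 2 → Fin 2 → Bool
differ 0F 0F = false
differ 0F 1F = true
differ 1F 0F = true
differ 1F 1F = false

differ-xor : ∀ s t u → differ s t xor differ t u ≡ differ s u
differ-xor 0F 0F 0F = refl
differ-xor 0F 0F 1F = refl
differ-xor 0F 1F 0F = refl
differ-xor 0F 1F 1F = refl
differ-xor 1F 0F 0F = refl
differ-xor 1F 0F 1F = refl
differ-xor 1F 1F 0F = refl
differ-xor 1F 1F 1F = refl

≡⇒¬differ : ∀ s → false ≡ differ s s
≡⇒¬differ 0F = refl
≡⇒¬differ 1F = refl

≢⇒differ : ∀ {s t} → s ≢ t → true ≡ differ s t
≢⇒differ {0F} {0F} s≢t = contradiction refl s≢t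
≢⇒differ {0F} {1F} s≢t = refl
≢⇒differ {1F} {0F} s≢t = refl
≢⇒differ {1F} {1F} s≢t = contradiction refl s≢t

At⇒crosses : ∀ {n} h {p q : Fin 2 × Fin n} →
  At (distanceOf h) p q → crosses h ≡ differ (proj₁ p) (proj₁ q)
At⇒crosses a (aside {s} _)    = ≡⇒¬differ s
At⇒crosses b (adjacent s≢t _) = ≢⇒differ s≢t
At⇒crosses c (matched s≢t)    = ≢⇒differ s≢t

-- A triangle crosses between the two sides an even number of times; this
-- leaves acc, cac and cca as the only other forbidden types.
triangle⇒cycle : ∀ {n} h i j {p q r : Fin 2 × Fin n} →
  At (distanceOf h) p q → At (distanceOf i) q r → At (distanceOf j) p r → Cycle h i j
triangle⇒cycle {n} h i j {p} {q} {r} pq qr pr = cycle h i j pq qr pr even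
  where
  even : crosses h xor crosses i ≡ crosses j
  even = trans (cong₂ _xor_ (At⇒crosses h pq) (At⇒crosses i qr))
        (trans (differ-xor (proj₁ p) (proj₁ q) (proj₁ r)) (sym (At⇒crosses j pr)))

  -- The parity equation is an argument so that it reduces once the colours are known. It is absurd
  -- for 14 of the 27 triples, leaving the ten cycles and three triples with two edges `c`.
  cycle : ∀ h i j {p q r : Fin 2 × Fin n} →
    At (distanceOf h) p q → At (distanceOf i) q r → At (distanceOf j) p r →
    crosses h xor crosses i ≡ crosses j → Cycle h i j
  cycle a a a _ _ _ refl = aaa
  cycle a b b _ _ _ refl = abb
  cycle b a b _ _ _ refl = bab
  cycle b b a _ _ _ refl = bba
  cycle a b c _ _ _ refl = abc
  cycle a c b _ _ _ refl = acb
  cycle b a c _ _ _ refl = bac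
  cycle b c a _ _ _ refl = bca
  cycle c a b _ _ _ refl = cab
  cycle c b a _ _ _ refl = cba
  cycle a c c (aside i≢i) (matched _) (matched _) refl = contradiction refl i≢i
  cycle c a c (matched _) (aside i≢i) (matched _) refl = contradiction refl i≢i
  cycle c c a (matched _) (matched _) (aside i≢i) refl = contradiction refl i≢i

-- Graphs with crown coordinates

module Crown {V : Set} {m : ℕ} (G : Graph V) (coords : V ↔ (Fin 2 × Fin (3 + m)))
  (Adj⇔At : ∀ x y → Adj G x y ⇔ At 1 (to coords x) (to coords y)) where

  n : ℕ
  n = 3 + m

  infix 4 _at_from_
  _at_from_ : V → ℕ → V → Set
  y at k from x = At k (to coords x) (to coords y)

  vertex : Fin 2 × Fin n → V
  vertex = from coords

  at-vertexʳ : ∀ {k x} p → At k (to coords x) p → vertex p at k from x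
  at-vertexʳ {k} {x} p = subst (At k (to coords x)) (sym (strictlyInverseˡ coords p))

  at-vertexˡ : ∀ {k x} p → At k p (to coords x) → x at k from vertex p
  at-vertexˡ {k} {x} p = subst (λ q → At k q (to coords x)) (sym (strictlyInverseˡ coords p))

  example : ∀ {k p q} → At k p q → ∃[ x ] ∃[ y ] y at k from x
  example {k} {p} {q} pq = vertex p , vertex q ,
    at-vertexˡ p (subst (At k p) (sym (strictlyInverseˡ coords q)) pq)

  colour-example : ∀ h → ∃[ x ] ∃[ y ] y at distanceOf h from x
  colour-example a = example (aside {s = 0F} {0F} {1F} λ ())
  colour-example b = example (adjacent {s = 0F} {1F} {0F} {1F} (λ ()) λ ())
  colour-example c = example (matched {s = 0F} {1F} {0F} λ ())

  -- Completed triangles supply intermediate vertices of walks: `abb` breaks a pair at position 2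
  -- into two edges, and `cba` breaks a pair at position 3 into an edge and a pair at position 2.
  walk-via : ∀ {i j h x y k} → Cycle h i j → y at distanceOf h from x →
    (∀ z → z at distanceOf i from x → Adj G x z) →
    (∀ z → y at distanceOf j from z → Walk G k z y) → Walk G (suc k) x y
  walk-via cyc xy first rest =
    let r , xr , ry = complete-triangle cyc xy
    in first (vertex r) (at-vertexʳ r xr) ∷ rest (vertex r) (at-vertexˡ r ry)

  at⇒adj : ∀ {x y} → y at 1 from x → Adj G x y
  at⇒adj = Equivalence.from (Adj⇔At _ _)

  at-1⇒walk : ∀ {x y} → y at 1 from x → Walk G 1 x y
  at-1⇒walk xy = at⇒adj xy ∷ []

  at-2⇒walk : ∀ {x y} → y at 2 from x → Walk G 2 x y
  at-2⇒walk xy = walk-via abb xy (λ _ → at⇒adj) (λ _ → at-1⇒walk)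

  at⇒walk : ∀ {k x y} → k ≤ 3 → y at k from x → Walk G k x y
  at⇒walk {0} _ xy with refl ← to-injective coords (At-0⇒≡ xy) = []
  at⇒walk {1} _ xy = at-1⇒walk xy
  at⇒walk {2} _ xy = at-2⇒walk xy
  at⇒walk {3} _ xy = walk-via cba xy (λ _ → at⇒adj) (λ _ → at-2⇒walk)
  at⇒walk {suc (suc (suc (suc _)))} (s≤s (s≤s (s≤s ())))

  at≤walk : ∀ {k l x y} → Walk G l x y → y at k from x → k ≤ l
  at≤walk {k} [] xx with refl ← At-unique xx equal = z≤n
  at≤walk (_∷_ {y = y} {z} xy w) xz =
    let l , _ , yz = position (to coords y) (to coords z)
    in ≤-trans (At-step (Equivalence.to (Adj⇔At _ _) xy) yz xz) (s≤s (at≤walk w yz))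

  -- Every pair has some position `l` at most 3; `at⇒walk` gives a walk of that length and `at≤walk`
  -- shows that none is shorter. Uniqueness of the position, or of the minimum, identifies `l` with
  -- `k`.
  dist⇔at : ∀ k x y → Dist G k x y ⇔ y at k from x
  dist⇔at k x y = mk⇔ dist⇒at at⇒dist
    where
    at⇒dist : ∀ {k} → y at k from x → Dist G k x y
    at⇒dist {k} xy with l , l≤3 , xy′ ← position (to coords x) (to coords y)
      with refl ← At-unique xy xy′ = at⇒walk l≤3 xy , λ _ w → at≤walk w xy

    dist⇒at : Dist G k x y → y at k from x
    dist⇒at (w , least) with l , l≤3 , xy ← position (to coords x) (to coords y)
      with refl ← ≤-antisym (at≤walk w xy) (least l (at⇒walk l≤3 xy)) = xy

  connected : Connected G
  connected x y =
    let k , k≤3 , xy = position (to coords x) (to coords y) in k , at⇒walk k≤3 xy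

  diameter : HasDiameter G 3
  diameter =
    (λ x y → let k , k≤3 , xy = position (to coords x) (to coords y)
             in k , k≤3 , Equivalence.from (dist⇔at k x y) xy) ,
    (let x , y , xy = colour-example c in x , y , Equivalence.from (dist⇔at 3 x y) xy)

  -- Homogeneity, distance-transitivity and the intersection array

  Preserves : V ↔ V → Set
  Preserves φ = ∀ k x y → y at k from x → to φ y at k from to φ x

  -- The coordinate action is conjugated by `coords`. Since all positions are preserved, the same
  -- permutation serves as a graph automorphism and as a colour-preserving permutation.
  homogeneous : ∀ {k x y u v} → y at k from x → v at k from u →
    Σ[ φ ∈ V ↔ V ] Preserves φ × to φ x ≡ u × to φ y ≡ v
  homogeneous {x = x} {y} {u} {v} xy uv =
    φ , preserves , trans (cong vertex gx) (strictlyInverseʳ coords u) ,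
    trans (cong vertex gy) (strictlyInverseʳ coords v)
    where
    moved = act-transitive xy uv
    g  = proj₁ moved
    gx = proj₁ (proj₂ moved)
    gy = proj₂ (proj₂ moved)

    φ : V ↔ V
    φ = ↔-sym coords ↔-∘ (act g ↔-∘ coords)

    preserves : Preserves φ
    preserves k p q pq = subst₂ (At k) (sym (strictlyInverseˡ coords _))
      (sym (strictlyInverseˡ coords _)) (act-At g pq)

  -- Each pair has exactly one position, so preserving all of them also reflects them; this gives
  -- the backward half of the automorphism condition.
  reflects : ∀ {k} φ → Preserves φ → ∀ x y → to φ y at k from to φ x → y at k from x
  reflects φ pres x y φxy with l , _ , xy ← position (to coords x) (to coords y)
    with refl ← At-unique φxy (pres l x y xy) = xy

  distance-transitive : IsDistanceTransitive G
  distance-transitive = connected , λ k x y u v xy uv →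
    let φ , pres , φx , φy =
          homogeneous (Equivalence.to (dist⇔at k x y) xy) (Equivalence.to (dist⇔at k u v) uv)
    in φ ,
       (λ p q → ⇔-sym (Adj⇔At _ _)
                ⇔-∘ (mk⇔ (pres 1 p q) (reflects φ pres p q) ⇔-∘ Adj⇔At p q)) ,
       φx , φy

  intersection-array : HasIntersectionArray G (outward n) (inward n)
  intersection-array = connected , diameter , ahead , behind
    where
    in-graph : ∀ {k l} x y →
      HasCardinality (λ r → At 1 (to coords y) r × At k (to coords x) r) l →
      HasCardinality (λ z → Adj G y z × Dist G k x z) l
    in-graph {k} x y = cardinality-cong
      (λ z → ⇔-sym (Adj⇔At y z) ×-⇔ ⇔-sym (dist⇔at k x z)) ∘ cardinality-↔ coords

    ahead : ∀ i x y → Dist G (toℕ i) x y →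
      HasCardinality (λ z → Adj G y z × Dist G (suc (toℕ i)) x z) (lookup (outward n) i)
    ahead i x y xy = in-graph x y
      (cardinality-outward i (Equivalence.to (dist⇔at _ x y) xy))

    behind : ∀ i x y → Dist G (suc (toℕ i)) x y →
      HasCardinality (λ z → Adj G y z × Dist G (toℕ i) x z) (lookup (inward n) i)
    behind i x y xy = in-graph x y
      (cardinality-inward i (Equivalence.to (dist⇔at _ x y) xy))

  order : HasCardinality {V} U (2 * n)
  order = cardinality-↔ (↔-sym *↔× ↔-∘ coords) (cardinality-Fin (2 * n))

  -- The distance colouring and its representation

  distance : V → V → ℕ
  distance x y = proj₁ (position (to coords x) (to coords y))

  distance-unique : ∀ {k} x y → y at k from x → distance x y ≡ k
  distance-unique x y xy =
    At-unique (proj₂ (proj₂ (position (to coords x) (to coords y)))) xy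

  colouring : Colouring V Colour
  colouring = record
    { colour     = λ x y _ → colourAt (distance x y)
    ; colour-sym = λ x y _ _ → cong colourAt (distance-unique x y
        (At-sym (proj₂ (proj₂ (position (to coords y) (to coords x))))))
    }

  coloured⇔at : ∀ h x y → Coloured colouring h x y ⇔ y at distanceOf h from x
  coloured⇔at h x y = mk⇔
    (λ { (x≢y , refl) → recolour (proj₂ (proj₂ (position (to coords x) (to coords y))))
                                 (x≢y ∘ to-injective coords) })
    (λ xy → (λ { refl → loop h xy }) ,
            trans (cong colourAt (distance-unique x y xy)) (colourAt-distanceOf h))
    where
    recolour : ∀ {k p q} → At k p q → p ≢ q → At {n} (distanceOf (colourAt k)) p q
    recolour equal            p≢p = contradiction refl p≢p
    recolour xy@(adjacent _ _) _  = xy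
    recolour xy@(aside _)      _  = xy
    recolour xy@(matched _)    _  = xy

    loop : ∀ h {p} → ¬ At {n} (distanceOf h) p p
    loop a (aside i≢i)      = i≢i refl
    loop b (adjacent _ i≢i) = i≢i refl
    loop c (matched s≢s)    = s≢s refl

  coloured⇔dist : ∀ h x y → Coloured colouring h x y ⇔ Dist G (distanceOf h) x y
  coloured⇔dist h x y = ⇔-sym (dist⇔at (distanceOf h) x y) ⇔-∘ coloured⇔at h x y

  coloured⇒at : ∀ {h x y} → Coloured colouring h x y → y at distanceOf h from x
  coloured⇒at = Equivalence.to (coloured⇔at _ _ _)

  at⇒coloured : ∀ {h x y} → y at distanceOf h from x → Coloured colouring h x y
  at⇒coloured = Equivalence.from (coloured⇔at _ _ _)

  representation : IsRepresentation atoms26₆₅ colouring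
  representation = record
    { used = used
    ; mandatory = λ h i j hij x y xy →
        let r , xr , ry = complete-triangle (mandatory⇒cycle h i j hij) (coloured⇒at xy)
        in vertex r , at⇒coloured (at-vertexʳ r xr) , at⇒coloured (at-vertexˡ r ry)
    ; forbidden = λ h i j ¬hij x y z (xy , yz , xz) →
        ¬hij (cycle⇒mandatory
          (triangle⇒cycle h i j (coloured⇒at xy) (coloured⇒at yz) (coloured⇒at xz)))
    }
    where
    used : ∀ h → ∃[ x ] ∃[ y ] Coloured colouring h x y
    used h = let x , y , xy = colour-example h in x , y , at⇒coloured xy

  preserves⇒colour-preserving : ∀ φ → Preserves φ → IsColourPreserving colouring φ
  preserves⇒colour-preserving φ pres h x y =
    at⇒coloured ∘ pres (distanceOf h) x y ∘ coloured⇒at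

  algebraic : IsAlgebraic colouring
  algebraic = identity-orbit , colour-orbit
    where
    identity-orbit : IsOrbit colouring _≡_
    identity-orbit = let x , _ = colour-example a in
      x , x , refl , λ u v → mk⇔
        -- Vertex-transitivity is homogeneity at position 0.
        (λ { refl → let φ , pres , φx , φy = homogeneous {x = x} {x} {u} {u} equal equal
                    in φ , preserves⇒colour-preserving φ pres , φx , φy })
        (λ (_ , _ , φx≡u , φx≡v) → trans (sym φx≡u) φx≡v)

    colour-orbit : ∀ h → IsOrbit colouring (Coloured colouring h)
    colour-orbit h = let x , y , xy = colour-example h in
      x , y , at⇒coloured xy , λ u v → mk⇔
        (λ uv → let φ , pres , φx , φy = homogeneous xy (coloured⇒at uv)
                in φ , preserves⇒colour-preserving φ pres , φx , φy)
        (λ { (φ , pres , refl , refl) → pres h x y (at⇒coloured xy) })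

-- Crown coordinates from a perfect matching

module Matching {n : ℕ} (M : Graph (Fin n ⊎ Fin n))
  (perfect : IsPerfectMatching (completeBipartite n n) M) where

  private
    inside  = proj₁ perfect
    partner = proj₂ perfect

  -- Matching edges are edges of the complete bipartite graph, so the partner of a left vertex
  -- cannot be on the left.
  rightPartner : ∀ i → ∃[ j ] Adj M (inj₁ i) (inj₂ j) ×
    (∀ {k} → Adj M (inj₁ i) (inj₂ k) → j ≡ k)
  rightPartner i with partner (inj₁ i)
  ... | inj₁ k , ik , _      = ⊥-elim (inside (inj₁ i) (inj₁ k) ik)
  ... | inj₂ j , ij , unique = j , ij , inj₂-injective ∘ unique

  leftPartner : ∀ j → ∃[ i ] Adj M (inj₂ j) (inj₁ i) ×
    (∀ {k} → Adj M (inj₂ j) (inj₁ k) → i ≡ k)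
  leftPartner j with partner (inj₂ j)
  ... | inj₁ i , ji , unique = i , ji , inj₁-injective ∘ unique
  ... | inj₂ k , jk , _      = ⊥-elim (inside (inj₂ j) (inj₂ k) jk)

  σ τ : Fin n → Fin n
  σ = proj₁ ∘ rightPartner
  τ = proj₁ ∘ leftPartner

  matched⇔ : ∀ i j → Adj M (inj₁ i) (inj₂ j) ⇔ i ≡ τ j
  matched⇔ i j = mk⇔
    (λ ij → sym (proj₂ (proj₂ (leftPartner j)) (Graph.sym M ij)))
    (λ { refl → Graph.sym M (proj₁ (proj₂ (leftPartner j))) })

  -- A right vertex is labelled by the index of its left partner, so matched vertices share their
  -- second coordinate. The inverse uses `σ`, and uniqueness of partners makes `σ` and `τ` mutually
  -- inverse.
  coordinates : (Fin n ⊎ Fin n) ↔ (Fin 2 × Fin n)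
  coordinates = mk↔ₛ′ toC fromC toC-fromC fromC-toC
    where
    toC : Fin n ⊎ Fin n → Fin 2 × Fin n
    toC (inj₁ i) = 0F , i
    toC (inj₂ j) = 1F , τ j

    fromC : Fin 2 × Fin n → Fin n ⊎ Fin n
    fromC (0F , i) = inj₁ i
    fromC (1F , i) = inj₂ (σ i)

    toC-fromC : ∀ p → toC (fromC p) ≡ p
    toC-fromC (0F , i) = refl
    toC-fromC (1F , i) = cong (1F ,_)
      (sym (Equivalence.to (matched⇔ i (σ i)) (proj₁ (proj₂ (rightPartner i)))))

    fromC-toC : ∀ x → fromC (toC x) ≡ x
    fromC-toC (inj₁ i) = refl
    fromC-toC (inj₂ j) = cong inj₂
      (proj₂ (proj₂ (rightPartner (τ j))) (Equivalence.from (matched⇔ (τ j) j) refl))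

  crown-adj : ∀ x y → Adj (completeBipartite n n ∖ M) x y ⇔
                      At 1 (to coordinates x) (to coordinates y)
  crown-adj (inj₁ i) (inj₁ j) = mk⇔ (λ ()) (λ { (adjacent s≢s _) → contradiction refl s≢s })
  crown-adj (inj₁ i) (inj₂ j) = mk⇔
    (λ (_ , ¬ij) → adjacent (λ ()) (¬ij ∘ Equivalence.from (matched⇔ i j)))
    (λ { (adjacent _ i≢τj) → tt , i≢τj ∘ Equivalence.to (matched⇔ i j) })
  crown-adj (inj₂ j) (inj₁ i) = mk⇔
    (λ (_ , ¬ji) → adjacent (λ ()) (¬ji ∘ Graph.sym M ∘ Equivalence.from (matched⇔ i j) ∘ sym))
    (λ { (adjacent _ τj≢i) → tt , τj≢i ∘ sym ∘ Equivalence.to (matched⇔ i j) ∘ Graph.sym M })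
  crown-adj (inj₂ i) (inj₂ j) = mk⇔ (λ ()) (λ { (adjacent s≢s _) → contradiction refl s≢s })

mainTheorem8 : (n : ℕ) → 3 ≤ n →
    (M : Graph (Fin n ⊎ Fin n)) → IsPerfectMatching (completeBipartite n n) M →
    let crown = completeBipartite n n ∖ M in
    IsDistanceTransitive crown ×
    HasDiameter crown 3 ×
    HasIntersectionArray crown ((n ∸ 1) ∷ (n ∸ 2) ∷ 1 ∷ []) (1 ∷ (n ∸ 2) ∷ (n ∸ 1) ∷ []) ×
    HasCardinality {Fin n ⊎ Fin n} U (2 * n) ×
    (Σ[ κ ∈ Colouring (Fin n ⊎ Fin n) Colour ]
    IsDistanceColouring crown κ ×
    IsRepresentation atoms26₆₅ κ ×
    IsAlgebraic κ)
mainTheorem8 (suc (suc (suc m))) (s≤s (s≤s (s≤s z≤n))) M perfect =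
  distance-transitive , diameter , intersection-array , order ,
  colouring ,
  (λ x y → coloured⇔dist b x y , coloured⇔dist a x y , coloured⇔dist c x y) ,
  representation , algebraic
  where
  open Matching M perfect
  open Crown (completeBipartite _ _ ∖ M) coordinates crown-adj
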